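{- For every integer $n\ge 1$ there is a bijection $\Phi:\mathcal{P}_n\to\mathcal{M}_n$ such that for every $P\in\mathcal{P}_n$, the number of north steps of $P$ equals the number of nestings $ne(\Phi(P))$ of the matching $\Phi(P)$.
   Context: A partially directed path is a lattice path in the plane starting at the origin and consisting of unit east $(1,0)$, north $(0,1)$ and south $(0,-1)$ steps, which is self-avoiding (so a north step is never immediately followed by a south step or vice versa). $\mathcal{P}_n$ denotes the set of such paths confined to the symmetric wedge $\{(x,y): -x\le y\le x\}$, having exactly $n$ east steps and ending on the line $y=-x$ (i.e. at $(n,-n)$). Equivalently, such a path is determined by the $y$-coordinates $a_1,\dots,a_n$ of its east steps, where $a_1,\dots,a_n$ is any sequence of integers with $-(i-1)\le a_i\le i-1$. A matching on $[2n]=\{1,\dots,2n\}$ is a partition of $[2n]$ into $n$ two-element blocks (edges); $\mathcal{M}_n$ is the set of all matchings on $[2n]$. Two edges $(a,b)$, $(c,d)$ (with $a<b$, $c<d$) form a nesting if $a<c<d<b$; $ne(M)$ is the number of nestings of $M$. -}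

module Defs where

open import Data.Nat as ℕ using (ℕ; zero; suc; _+_; _*_)
open import Data.Integer as ℤ using (ℤ; +_; -[1+_]; -_; _-_)
open import Data.Fin as Fin using (Fin)
open import Data.Fin.Properties using (all?)
open import Data.Vec using (Vec; []; _∷_; lookup)
open import Data.List using (List; []; _∷_; _++_; replicate; length; filter; cartesianProduct)
open import Data.List using () renaming (map to lmap)
open import Data.Product using (Σ; _×_; _,_; proj₁; proj₂)
open import Data.Sum using (_⊎_)
open import Relation.Binary.PropositionalEquality using (_≡_)
open import Relation.Nullary using (Dec)
open import Relation.Nullary.Decidable using (_×-dec_)
import Data.Fin.Properties as FinP
open import Data.List.Base using (allFin)

-- Partially directed paths in the symmetric wedge, ending at (n , -n).
-- Encoded (as in the paper) by the heights a₁,…,aₙ of the east steps,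
-- subject to -(i-1) ≤ aᵢ ≤ i-1.  The k index is the bound i-1.

data Bounded : {m : ℕ} → ℕ → Vec ℤ m → Set where
  []  : {k : ℕ} → Bounded k []
  _∷_ : {m k : ℕ} {a : ℤ} {v : Vec ℤ m} →
        (ℤ.- (+ k) ℤ.≤ a × a ℤ.≤ + k) → Bounded (suc k) v → Bounded k (a ∷ v)

PathP : ℕ → Set
PathP n = Σ (Vec ℤ n) (λ a → Bounded 0 a)

data Step : Set where
  E N S : Step

-- Vertical run from height h to height h' (self-avoiding: only N's or only S's).
vert : ℤ → ℤ → List Step
vert h h' with h' - h
... | + k      = replicate k N
... | -[1+ k ] = replicate (suc k) S

stepsFrom : {m : ℕ} → ℤ → Vec ℤ m → ℤ → List Step
stepsFrom h []      final = vert h final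
stepsFrom h (a ∷ v) final = vert h a ++ (E ∷ stepsFrom a v final)

steps : (n : ℕ) → PathP n → List Step
steps n (a , _) = stepsFrom (+ 0) a (ℤ.- (+ n))

countN : List Step → ℕ
countN []       = 0
countN (N ∷ ss) = suc (countN ss)
countN (E ∷ ss) = countN ss
countN (S ∷ ss) = countN ss

northSteps : (n : ℕ) → PathP n → ℕ
northSteps n P = countN (steps n P)

-- Matchings on [2n], encoded canonically as fixed-point-free involutions
-- of Fin (2n) (the partner of each point), stored as a vector.

partner : {L : ℕ} → Vec (Fin L) L → Fin L → Fin L
partner m i = lookup m i

IsMatching : {L : ℕ} → Vec (Fin L) L → Set
IsMatching {L} m = Data.Vec.Relation.Unary.All.All (λ i → (partner m (partner m i) ≡ i) × ((i Fin.< partner m i) ⊎ (partner m i Fin.< i))) (Data.Vec.allFin L)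
  where import Data.Vec.Relation.Unary.All
        import Data.Vec

Matching : ℕ → Set
Matching n = Σ (Vec (Fin (2 * n)) (2 * n)) IsMatching

nestingAt? : {L : ℕ} (m : Vec (Fin L) L) (p : Fin L × Fin L) →
             Dec ((proj₁ p Fin.< proj₂ p) × (proj₂ p Fin.< partner m (proj₂ p)) × (partner m (proj₂ p) Fin.< partner m (proj₁ p)))
nestingAt? m (i , j) = (i Fin.<? j) ×-dec ((j Fin.<? partner m j) ×-dec (partner m j Fin.<? partner m i))

ne : (n : ℕ) → Matching n → ℕ
ne n (m , _) = length (filter (nestingAt? m) (cartesianProduct (allFin (2 * n)) (allFin (2 * n))))

{-# OPTIONS --safe #-}
module Submission where

-- Cut a matching on c + r points after its first c points, and let S(c,r) be the
-- sum over all matchings of q^(nestings + arcs right of the cut).  Record a matching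
-- by a labelled history on each side of the cut; a closer that can choose among k+1
-- open arcs contributes [k+1] = 1 + q[k].  Moving the cut past one point, this
-- identity becomes an explicit bijection proving
--   S(c,s) = Σ { q^max(d+1-c,0) S(d,r) | d + r = c + s - 2 }.
-- Paths obey the same recursion: code a height a with |a| ≤ k by c = k - a and
-- s = k + a; from the height coded by d to the next one, coded by c, a path takes
-- max(d+1-c,0) north steps.  The end point (n,-n) is coded by the cut (2n,0), for
-- which nothing lies right of the cut.

open import Defs
open import Data.Nat as ℕ using (ℕ; zero; suc; _+_; _*_; _∸_; _≤_; _≥_; s≤s; z<s; s<s)
open import Data.Nat.Properties as ℕ using
  ( +-suc; +-assoc; +-identityʳ; +-cancelˡ-≡; *-identityˡ; +-∸-assoc; +-0-commutativeMonoid
  ; m∸n+n≡m; m+[n∸m]≡n; n∸n≡0; m≤n⇒m∸n≡0; m≤n⇒m≤1+n; m≤m+n; m+n≤o⇒m≤o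
  ; ≤-refl; ≤-trans; ≤-reflexive; <⇒≤; n≮n; <-≤-connex; suc-injective )
open import Data.Nat.Solver using (module +-*-Solver)
open import Data.Integer as ℤ using (ℤ; +_; -[1+_]; _⊖_; ∣_∣)
import Data.Integer.Properties as ℤ
import Data.Integer.Solver as ℤSolver
open import Data.Fin as Fin using (Fin; zero; suc; toℕ; opposite; punchIn; punchOut; _<_; _<?_; _≟_)
import Data.Fin.Properties as Fin
open import Data.List as List using (List; []; _∷_; _++_; replicate)
import Data.List.Properties as List
open import Data.Vec using (Vec; []; _∷_; lookup; tabulate)
open import Data.Vec.Properties using (lookup∘tabulate; tabulate∘lookup; tabulate-cong)
import Data.Vec.Relation.Unary.All as All
import Data.Vec.Relation.Unary.All.Properties as All
open import Data.Bool using (if_then_else_)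
open import Data.Empty using (⊥-elim)
open import Data.Product using (Σ; ∃; ∃₂; _×_; _,_; proj₁; proj₂)
open import Data.Sum using (_⊎_; inj₁; inj₂)
open import Function using (_∘_; id)
open import Function.Bundles using (Bijection)
open import Relation.Nullary using (Dec; yes; no; does; ¬_; contradiction)
open import Relation.Nullary.Decidable using (_×-dec_; _⊎-dec_)
open import Relation.Unary using (Decidable)
open import Relation.Binary.Definitions using (tri<; tri≈; tri>)
open import Relation.Binary.PropositionalEquality using
  (_≡_; _≢_; _≗_; refl; sym; trans; cong; cong₂; subst; subst₂; setoid; module ≡-Reasoning)
open import Axiom.UniquenessOfIdentityProofs.WithK using (uip)
open import Algebra.Properties.CommutativeMonoid.Sum +-0-commutativeMonoid using
  (sum; sum-cong-≗; sum-remove; ∑-distrib-+; sum-replicate-zero)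

private variable
  a               : ℤ
  c r d s k m n   : ℕ

-- Moving a cut through a matching

-- The history of the points left of a cut crossed by k arcs: the last of them opens
-- an arc or closes one of the open arcs, whose label is the number of nestings that
-- this creates.
data Left : ℕ → ℕ → Set where
  nil : Left 0 0
  op  : Left m k → Left (suc m) (suc k)
  cl  : Left m (suc k) → Fin (suc k) → Left (suc m) k

-- The points right of a cut crossed by k arcs: the first of them opens an arc (up)
-- or closes a crossing one (dn).
data Right : ℕ → ℕ → Set where
  nil : Right 0 0
  up  : Right m (suc k) → Right (suc m) k
  dn  : Fin (suc k) → Right m k → Right (suc m) (suc k)

wtL : Left m k → ℕ
wtL nil      = 0
wtL (op l)   = wtL l
wtL (cl l j) = toℕ j + wtL l

-- An opener right of the cut starts an arc lying wholly right of it, so counting `up` once counts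
-- these arcs.
wtR : Right m k → ℕ
wtR nil      = 0
wtR (up ρ)   = suc (wtR ρ)
wtR (dn i ρ) = toℕ i + wtR ρ

-- In CutA the point right after the cut is a closer and in CutB an opener; the factor
-- q of that opener is left out of wtB.
Cut CutA CutB : ℕ → ℕ → Set
Cut  c r = ∃ λ k → Left c k × Right r k
CutA c r = ∃ λ k → Left c (suc k) × Fin (suc k) × Right r k
CutB c r = ∃ λ k → Left c k × Right r (suc k)

wt : Cut c r → ℕ
wt (_ , l , ρ) = wtL l + wtR ρ

wtA : CutA c r → ℕ
wtA (_ , l , j , ρ) = wtL l + (toℕ j + wtR ρ)

wtB : CutB c r → ℕ
wtB (_ , l , ρ) = wtL l + wtR ρ

-- Lower d s c r says d < c, and Upper d s c r says c ≤ d, both with d + s + 1 = c + r.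
-- They index the summands Cut d s of CutA c r and of CutB c r.
data Lower (d s : ℕ) : ℕ → ℕ → Set where
  here  : Lower d s (suc d) s
  there : Lower d s c (suc r) → Lower d s (suc c) r

data Upper (d s : ℕ) : ℕ → ℕ → Set where
  here  : Upper d s d (suc s)
  there : Upper d s (suc c) r → Upper d s c (suc r)

-- `last` handles a cut with nothing to its right: no arc crosses it, so its last point is a closer,
-- which plays the part of the closer after a cut placed one point earlier.
data Move (d s : ℕ) : ℕ → ℕ → Set where
  lower : Lower d s c r → Move d s c (suc r)
  upper : Upper d s c r → Move d s c (suc r)
  last  : Lower d s c 0 → Move d s (suc c) 0

-- A closer followed by an opener trades places with it, and the factor q that the opener loses on
-- the left becomes one more unit of label; two closers are only regrouped. What is missed is `op`
-- followed by label `zero`, the 1 in [k+1] = 1 + q[k]. With A(c,r) the sum over `CutA c r`, this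
-- says A(c+1,r) = S(c,r) + A(c,r+1).
shiftA : CutA c (suc r) → CutA (suc c) r
shiftA (_ , l , j , up ρ)   = _ , op l , suc j , ρ
shiftA (_ , l , j , dn i ρ) = _ , cl l j , i , ρ

insA : Lower d s c r → Cut d s → CutA c r
insA here      (k , l , ρ) = k , op l , zero , ρ
insA (there p) x           = shiftA (insA p x)

-- Undoes `shiftA` until an `op` with label `zero` appears. It must appear, because `CutA 0 r` is
-- empty: no arc is open before the first point.
delA : CutA c r → ∃₂ λ d s → Lower d s c r × Cut d s
delA (_ , op l   , zero  , ρ) = _ , _ , here , _ , l , ρ
delA (_ , op {k = suc _} l , suc j , ρ) with delA (_ , l , j , up ρ)
... | d , s , p , x = d , s , there p , x
delA (_ , cl l j , i     , ρ) with delA (_ , l , j , dn i ρ)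
... | d , s , p , x = d , s , there p , x

delA-shiftA : (y : CutA c (suc r)) → let (d , s , p , x) = delA y in
              delA (shiftA y) ≡ (d , s , there p , x)
delA-shiftA (_ , l , j , up ρ)   = refl
delA-shiftA (_ , l , j , dn i ρ) = refl

delA-insA : (p : Lower d s c r) (x : Cut d s) → delA (insA p x) ≡ (d , s , p , x)
delA-insA here      x = refl
delA-insA (there p) x rewrite delA-shiftA (insA p x) | delA-insA p x = refl

insA-delA : (y : CutA c r) → let (d , s , p , x) = delA y in insA p x ≡ y
insA-delA (_ , op l   , zero  , ρ) = refl
insA-delA (_ , op {k = suc _} l , suc j , ρ) = cong shiftA (insA-delA (_ , l , j , up ρ))
insA-delA (_ , cl l j , i     , ρ) = cong shiftA (insA-delA (_ , l , j , dn i ρ))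

wtA-shiftA : (y : CutA c (suc r)) → wtA (shiftA y) ≡ wtA y
wtA-shiftA (_ , l , j , up ρ)   = cong (_+_ (wtL l)) (sym (+-suc (toℕ j) (wtR ρ)))
wtA-shiftA (_ , l , j , dn i ρ) = solve 4 (λ a b c d → (a :+ b) :+ (c :+ d) := b :+ (a :+ (c :+ d))) refl (toℕ j) (wtL l) (toℕ i) (wtR ρ)
  where open +-*-Solver

wtA-insA : (p : Lower d s c r) (x : Cut d s) → wtA (insA p x) ≡ wt x
wtA-insA here      x = refl
wtA-insA (there p) x = trans (wtA-shiftA (insA p x)) (wtA-insA p x)

-- The last point on the left moves behind the opener after the cut. An opener gains its factor q
-- there; a closer sees one more open arc and its label grows by one. What is missed is `dn zero`.
-- With B(c,r) the sum over `CutB c r`, this says B(c,r+1) = S(c,r) + q B(c+1,r), and B(c,0) = 0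
-- ends the iteration.
shiftB : CutB (suc c) r → CutB c (suc r)
shiftB (_ , op l   , ρ) = _ , l , up ρ
shiftB (_ , cl l j , ρ) = _ , l , dn (suc j) ρ

insB : Upper d s c r → Cut d s → CutB c r
insB here      (_ , l , ρ) = _ , l , dn zero ρ
insB (there p) x           = shiftB (insB p x)

delB : CutB c r → ∃₂ λ d s → Upper d s c r × Cut d s
delB (_ , l , dn zero ρ)    = _ , _ , here , _ , l , ρ
delB (_ , l , dn {k = suc _} (suc j) ρ) with delB (_ , cl l j , ρ)
... | d , s , p , x = d , s , there p , x
delB (_ , l , up ρ)         with delB (_ , op l , ρ)
... | d , s , p , x = d , s , there p , x

delB-shiftB : (y : CutB (suc c) r) → let (d , s , p , x) = delB y in
              delB (shiftB y) ≡ (d , s , there p , x)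
delB-shiftB (_ , op l   , ρ) = refl
delB-shiftB (_ , cl l j , ρ) = refl

delB-insB : (p : Upper d s c r) (x : Cut d s) → delB (insB p x) ≡ (d , s , p , x)
delB-insB here      x = refl
delB-insB (there p) x rewrite delB-shiftB (insB p x) | delB-insB p x = refl

insB-delB : (y : CutB c r) → let (d , s , p , x) = delB y in insB p x ≡ y
insB-delB (_ , l , dn zero ρ)    = refl
insB-delB (_ , l , dn {k = suc _} (suc j) ρ) = cong shiftB (insB-delB (_ , cl l j , ρ))
insB-delB (_ , l , up ρ)         = cong shiftB (insB-delB (_ , op l , ρ))

wtB-shiftB : (y : CutB (suc c) r) → wtB (shiftB y) ≡ suc (wtB y)
wtB-shiftB (_ , op l   , ρ) = +-suc (wtL l) (wtR ρ)
wtB-shiftB (_ , cl l j , ρ) = solve 3 (λ a b c → a :+ (con 1 :+ (b :+ c)) := con 1 :+ ((b :+ a) :+ c)) refl (wtL l) (toℕ j) (wtR ρ)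
  where open +-*-Solver

Upper⇒≤ : Upper d s c r → c ≤ d
Upper⇒≤ here      = ≤-refl
Upper⇒≤ (there p) = <⇒≤ (Upper⇒≤ p)

Lower⇒< : Lower d s c r → suc d ≤ c
Lower⇒< here      = ≤-refl
Lower⇒< (there p) = m≤n⇒m≤1+n (Lower⇒< p)

-- Each use of `shiftB` costs one factor q, and getting from d down to c takes d - c of them.
wtB-insB : (p : Upper d s c r) (x : Cut d s) → wtB (insB p x) ≡ d ∸ c + wt x
wtB-insB {d} here x rewrite n∸n≡0 d = refl
wtB-insB {d} (there {c} p) x = begin
  wtB (shiftB (insB p x))    ≡⟨ wtB-shiftB (insB p x) ⟩
  suc (wtB (insB p x))       ≡⟨ cong suc (wtB-insB p x) ⟩
  suc (d ∸ suc c) + wt x     ≡⟨ cong (_+ wt x) (sym (+-∸-assoc 1 (Upper⇒≤ p))) ⟩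
  d ∸ c + wt x               ∎
  where open ≡-Reasoning

-- The recursion for cuts, assembled from its summands

joinA : CutA c r → Cut c (suc r)
joinA (_ , l , j , ρ) = _ , l , dn j ρ

joinB : CutB c r → Cut c (suc r)
joinB (_ , l , ρ) = _ , l , up ρ

joinLast : CutA c 0 → Cut (suc c) 0
joinLast (_ , l , j , ρ) = _ , cl l j , ρ

ins : Move d s c r → Cut d s → Cut c r
ins (lower p) x = joinA (insA p x)
ins (upper p) x = joinB (insB p x)
ins (last p)  x = joinLast (insA p x)

-- The equation excludes the cut (0,0), which has no points to delete.
del : c + r ≡ suc m → Cut c r → ∃₂ λ d s → Move d s c r × Cut d s
del {r = suc r} _ (_ , l , dn j ρ) with delA (_ , l , j , ρ)
... | d , s , p , x = d , s , lower p , x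
del {r = suc r} _ (_ , l , up ρ) with delB (_ , l , ρ)
... | d , s , p , x = d , s , upper p , x
del {suc c} {zero} _ (0 , cl l j , nil) with delA (0 , l , j , nil)
... | d , s , p , x = d , s , last p , x

del-ins : (e : c + r ≡ suc m) (p : Move d s c r) (x : Cut d s) → del e (ins p x) ≡ (d , s , p , x)
del-ins e (lower p) x rewrite delA-insA p x = refl
del-ins e (upper p) x rewrite delB-insB p x = refl
del-ins e (last p)  x with insA p x | delA-insA p x
... | 0 , l , j , nil | eq rewrite eq = refl

ins-del : (e : c + r ≡ suc m) (y : Cut c r) → let (d , s , p , x) = del e y in ins p x ≡ y
ins-del {r = suc r} e (_ , l , dn j ρ) = cong joinA (insA-delA (_ , l , j , ρ))
ins-del {r = suc r} e (_ , l , up ρ)       = cong joinB (insB-delB (_ , l , ρ))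
ins-del {suc c} {zero} e (0 , cl l j , nil) = cong joinLast (insA-delA (0 , l , j , nil))

wt-joinLast : (y : CutA c 0) → wt (joinLast y) ≡ wtA y
wt-joinLast (_ , l , j , ρ) = solve 3 (λ a b c → (a :+ b) :+ c := b :+ (a :+ c)) refl (toℕ j) (wtL l) (wtR ρ)
  where open +-*-Solver

-- For `lower` and `last` the difference is truncated to 0. For `upper` the extra 1 over d - c is
-- the factor q of the opener that `wtB` leaves out.
wt-ins : (p : Move d s c r) (x : Cut d s) → wt (ins p x) ≡ suc d ∸ c + wt x
wt-ins (lower p) x rewrite m≤n⇒m∸n≡0 (Lower⇒< p) = wtA-insA p x
wt-ins {d} (upper {c} p) x = begin
  wt (joinB (insB p x))        ≡⟨ +-suc (wtL (proj₁ (proj₂ (insB p x)))) (wtR (proj₂ (proj₂ (insB p x)))) ⟩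
  suc (wtB (insB p x))         ≡⟨ cong suc (wtB-insB p x) ⟩
  suc (d ∸ c) + wt x           ≡⟨ cong (_+ wt x) (sym (+-∸-assoc 1 (Upper⇒≤ p))) ⟩
  suc d ∸ c + wt x             ∎
  where open ≡-Reasoning
wt-ins (last p)  x rewrite m≤n⇒m∸n≡0 (m≤n⇒m≤1+n (Lower⇒< p)) = trans (wt-joinLast (insA p x)) (wtA-insA p x)

-- Totals, uniqueness and existence of moves

Lower-sum : Lower d s c r → c + r ≡ suc (d + s)
Lower-sum here = refl
Lower-sum (there {c} {r} p) = trans (sym (+-suc c r)) (Lower-sum p)

Upper-sum : Upper d s c r → c + r ≡ suc (d + s)
Upper-sum {d} {s} here = +-suc d s
Upper-sum (there {c} {r} p) = trans (+-suc c r) (Upper-sum p)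

Move-sum : Move d s c r → c + r ≡ suc (suc (d + s))
Move-sum (lower {c} {r} p) = trans (+-suc c r) (cong suc (Lower-sum p))
Move-sum (upper {c} {r} p) = trans (+-suc c r) (cong suc (Upper-sum p))
Move-sum (last p)  = cong suc (Lower-sum p)

Lower-irrelevant : (p q : Lower d s c r) → p ≡ q
Lower-irrelevant here      here      = refl
Lower-irrelevant here      (there q) with () ← n≮n _ (Lower⇒< q)
Lower-irrelevant (there p) here      with () ← n≮n _ (Lower⇒< p)
Lower-irrelevant (there p) (there q) = cong there (Lower-irrelevant p q)

Upper-irrelevant : (p q : Upper d s c r) → p ≡ q
Upper-irrelevant here      here      = refl
Upper-irrelevant here      (there q) with () ← n≮n _ (Upper⇒≤ q)
Upper-irrelevant (there p) here      with () ← n≮n _ (Upper⇒≤ p)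
Upper-irrelevant (there p) (there q) = cong there (Upper-irrelevant p q)

-- Makes a walk determined by the cuts it visits, hence by the heights of a path.
Move-irrelevant : (p q : Move d s c r) → p ≡ q
Move-irrelevant (lower p) (lower q) = cong lower (Lower-irrelevant p q)
Move-irrelevant (lower p) (upper q) with () ← n≮n _ (≤-trans (Lower⇒< p) (Upper⇒≤ q))
Move-irrelevant (upper p) (lower q) with () ← n≮n _ (≤-trans (Lower⇒< q) (Upper⇒≤ p))
Move-irrelevant (upper p) (upper q) = cong upper (Upper-irrelevant p q)
Move-irrelevant (last p)  (last q)  = cong last (Lower-irrelevant p q)

lowerBy : ∀ e → e + r ≡ s → Lower d s (e + suc d) r
lowerBy zero    refl = here
lowerBy {r} (suc e) eq = there (lowerBy e (trans (+-suc e r) eq))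

upperBy : ∀ e → suc (e + s) ≡ r → Upper (e + c) s c r
upperBy zero refl = here
upperBy {s} {c = c} (suc e) refl = there (subst (λ d → Upper d s (suc c) (suc (e + s))) (+-suc e c) (upperBy e refl))

mkLower : suc d ≤ c → c + r ≡ suc (d + s) → Lower d s c r
mkLower {d} {c} {r} {s} d<c e =
  subst (λ c → Lower d s c r) (m∸n+n≡m d<c) (lowerBy (c ∸ suc d) (+-cancelˡ-≡ (suc d) _ _ (begin
    suc d + (c ∸ suc d + r) ≡⟨ sym (+-assoc (suc d) (c ∸ suc d) r) ⟩
    suc d + (c ∸ suc d) + r ≡⟨ cong (_+ r) (m+[n∸m]≡n d<c) ⟩
    c + r                   ≡⟨ e ⟩
    suc d + s               ∎)))
  where open ≡-Reasoning

mkUpper : c ≤ d → c + r ≡ suc (d + s) → Upper d s c r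
mkUpper {c} {d} {r} {s} c≤d e =
  subst (λ d → Upper d s c r) (m∸n+n≡m c≤d) (upperBy (d ∸ c) (+-cancelˡ-≡ c _ _ (begin
    c + suc (d ∸ c + s)     ≡⟨ +-suc c (d ∸ c + s) ⟩
    suc (c + (d ∸ c + s))   ≡⟨ cong suc (sym (+-assoc c (d ∸ c) s)) ⟩
    suc (c + (d ∸ c) + s)   ≡⟨ cong (λ n → suc (n + s)) (m+[n∸m]≡n c≤d) ⟩
    suc (d + s)             ≡⟨ sym e ⟩
    c + r                   ∎)))
  where open ≡-Reasoning

-- The totals are the only constraint on a move, just as consecutive heights of a path are
-- constrained only by their bounds.
mkMove : c + r ≡ suc (suc (d + s)) → Move d s c r
mkMove {suc c} {zero} {d} {s} e =
  last (mkLower (subst (suc d ≤_) (sym (trans (sym (+-identityʳ c)) (suc-injective e))) (s≤s (m≤m+n d s)))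
                (suc-injective e))
mkMove {c} {suc r} {d} {s} e with <-≤-connex d c
... | inj₁ d<c = lower (mkLower d<c (suc-injective (trans (sym (+-suc c r)) e)))
... | inj₂ c≤d = upper (mkUpper c≤d (suc-injective (trans (sym (+-suc c r)) e)))

-- Paths as walks of cuts

data Walk (c r : ℕ) : ℕ → ℕ → ℕ → Set where
  []  : Walk c r 0 c r
  _∷_ : ∀ {d s d′ s′} → Move d s d′ s′ → Walk c r m d′ s′ → Walk c r (suc m) d s

wtW : Walk c r m d s → ℕ
wtW []                     = 0
wtW (_∷_ {d = d} {d′ = d′} p t) = suc d ∸ d′ + wtW t

-- Computed by raising b, so that `rewind` can hand its equation to the recursive call unchanged.
after : ℕ → ℕ → ℕ
after zero    b = b
after (suc m) b = after m (suc (suc b))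

after≡ : ∀ m b → after m b ≡ 2 * m + b
after≡ zero b = refl
after≡ (suc m) b = trans (after≡ m (suc (suc b))) (solve 2 (λ m b → con 2 :* m :+ (con 2 :+ b) := con 2 :* (con 1 :+ m) :+ b) refl m b)
  where open +-*-Solver

run : Walk c r m d s → Cut d s → Cut c r
run []      x = x
run (p ∷ t) x = run t (ins p x)

wt-run : (t : Walk c r m d s) (x : Cut d s) → wt (run t x) ≡ wtW t + wt x
wt-run []      x = refl
wt-run (_∷_ {d = d} {d′ = d′} p t) x = begin
  wt (run t (ins p x))              ≡⟨ wt-run t (ins p x) ⟩
  wtW t + wt (ins p x)              ≡⟨ cong (_+_ (wtW t)) (wt-ins p x) ⟩
  wtW t + (suc d ∸ d′ + wt x)       ≡⟨ solve 3 (λ a b c → a :+ (b :+ c) := (b :+ a) :+ c) refl (wtW t) (suc d ∸ d′) (wt x) ⟩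
  suc d ∸ d′ + wtW t + wt x         ∎
  where open ≡-Reasoning; open +-*-Solver

-- Only the total of the starting cut is known in advance; its position is found by the deletions.
Origin : (c r m b : ℕ) → Set
Origin c r m b = ∃₂ λ d s → d + s ≡ b × Walk c r m d s × Cut d s

unstep : ∀ {b} → Origin c r m (suc (suc b)) → Origin c r (suc m) b
unstep (d′ , s′ , e , t , y) =
  let (d , s , p , x) = del e y in
  d , s , suc-injective (suc-injective (trans (sym (Move-sum p)) e)) , p ∷ t , x

rewind : ∀ m b → c + r ≡ after m b → Cut c r → Origin c r m b
rewind zero    b e y = _ , _ , e , [] , y
rewind (suc m) b e y = unstep (rewind m (suc (suc b)) e y)

run-rewind : ∀ m b (e : c + r ≡ after m b) (y : Cut c r) →
             let (_ , _ , _ , t , x) = rewind m b e y in run t x ≡ y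
run-rewind zero    b e y = refl
run-rewind (suc m) b e y with rewind m (suc (suc b)) e y | run-rewind m (suc (suc b)) e y
... | d , s , e′ , t , x | eq = trans (cong (run t) (ins-del e′ x)) eq

rewind-run : ∀ b (e : c + r ≡ after m b) (e′ : d + s ≡ b) (t : Walk c r m d s) (x : Cut d s) →
             rewind m b e (run t x) ≡ (d , s , e′ , t , x)
rewind-run b e e′ [] x = cong (λ e → _ , _ , e , [] , x) (uip e e′)
rewind-run {m = suc m} b e e′ (p ∷ t) x
  rewrite rewind-run {m = m} (suc (suc b)) e (trans (Move-sum p) (cong (λ n → suc (suc n)) e′)) t (ins p x)
        | del-ins (trans (Move-sum p) (cong (λ n → suc (suc n)) e′)) p x
  = cong (λ e → _ , _ , e , p ∷ t , x) (uip _ e′)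

start : Cut 0 0
start = 0 , nil , nil

start-unique : (x : Cut 0 0) → x ≡ start
start-unique (_ , nil , nil) = refl

run-start-injective : c + r ≡ 2 * m → (t u : Walk c r m 0 0) → run t start ≡ run u start → t ≡ u
run-start-injective {c} {r} {m} e t u eq = helper (begin
  (0 , 0 , refl , t , start)     ≡⟨ sym (rewind-run 0 e′ refl t start) ⟩
  rewind m 0 e′ (run t start)    ≡⟨ cong (rewind m 0 e′) eq ⟩
  rewind m 0 e′ (run u start)    ≡⟨ rewind-run 0 e′ refl u start ⟩
  (0 , 0 , refl , u , start)     ∎)
  where
  open ≡-Reasoning
  e′ = trans e (sym (trans (after≡ m 0) (+-identityʳ (2 * m))))
  helper : {t u : Walk c r m 0 0} →
           _≡_ {A = Origin c r m 0} (0 , 0 , refl , t , start) (0 , 0 , refl , u , start) → t ≡ u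
  helper refl = refl

run-start-surjective : c + r ≡ 2 * m → (y : Cut c r) → ∃ λ (t : Walk c r m 0 0) → run t start ≡ y
run-start-surjective {c} {r} {m} e y
  with rewind m 0 e′ y | run-rewind m 0 e′ y
  where e′ = trans e (sym (trans (after≡ m 0) (+-identityʳ (2 * m))))
-- Total 0 leaves only the cut (0,0), whose one element is `start`.
... | zero , zero , _ , t , x | eq rewrite start-unique x = t , eq

-- Heights of a path as positions of a cut

InRange : ℕ → ℤ → Set
InRange k a = (ℤ.- (+ k) ℤ.≤ a) × (a ℤ.≤ + k)

record Height (k : ℕ) : Set where
  constructor split
  field
    above below : ℕ
    total       : above + below ≡ 2 * k

open Height

from-top : InRange k a → + ∣ + k ℤ.- a ∣ ≡ + k ℤ.- a
from-top (_ , a≤k) = ℤ.0≤i⇒+∣i∣≡i (ℤ.i≤j⇒0≤j-i a≤k)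

from-bottom : InRange k a → + ∣ a ℤ.- ℤ.- (+ k) ∣ ≡ a ℤ.- ℤ.- (+ k)
from-bottom (-k≤a , _) = ℤ.0≤i⇒+∣i∣≡i (ℤ.i≤j⇒0≤j-i -k≤a)

height : InRange k a → Height k
height {k} {a} b = split ∣ + k ℤ.- a ∣ ∣ a ℤ.- ℤ.- (+ k) ∣ (ℤ.+-injective (begin
  + (∣ + k ℤ.- a ∣ + ∣ a ℤ.- ℤ.- (+ k) ∣)       ≡⟨ cong₂ ℤ._+_ (from-top b) (from-bottom b) ⟩
  + k ℤ.- a ℤ.+ (a ℤ.- ℤ.- (+ k))               ≡⟨ solve 2 (λ k a → k :- a :+ (a :- (:- k)) := k :+ (k :+ con (+ 0))) refl (+ k) a ⟩
  + (2 * k)                                     ∎))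
  where open ≡-Reasoning; open ℤSolver.+-*-Solver

value : Height k → ℤ
value {k} x = + k ℤ.- + above x

value-height : (b : InRange k a) → value (height b) ≡ a
value-height {k} {a} b = begin
  + k ℤ.- + ∣ + k ℤ.- a ∣     ≡⟨ cong (ℤ._-_ (+ k)) (from-top b) ⟩
  + k ℤ.- (+ k ℤ.- a)         ≡⟨ solve 2 (λ k a → k :- (k :- a) := a) refl (+ k) a ⟩
  a                           ∎
  where open ≡-Reasoning; open ℤSolver.+-*-Solver

above-injective : (x y : Height k) → above x ≡ above y → x ≡ y
above-injective (split d s e) (split d s′ e′) refl with refl ← +-cancelˡ-≡ d s s′ (trans e (sym e′)) =
  cong (split d s) (uip e e′)

height-value : (x : Height k) (b : InRange k (value x)) → height b ≡ x
height-value {k} x b = above-injective (height b) x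
  (cong ∣_∣ (solve 2 (λ k d → k :- (k :- d) := d) refl (+ k) (+ above x)))
  where open ℤSolver.+-*-Solver

value-inRange : (x : Height k) → InRange k (value x)
value-inRange {k} x = lower-bound , ℤ.i-j≤i (+ k) (+ above x)
  where
  open ℤ.≤-Reasoning; open ℤSolver.+-*-Solver
  lower-bound : ℤ.- (+ k) ℤ.≤ value x
  lower-bound = begin
    ℤ.- (+ k)             ≡⟨ solve 1 (λ k → :- k := k :- (k :+ (k :+ con (+ 0)))) refl (+ k) ⟩
    + k ℤ.- + (2 * k)     ≤⟨ ℤ.+-monoʳ-≤ (+ k) (ℤ.neg-mono-≤ (ℤ.+≤+ (m+n≤o⇒m≤o (above x) (≤-reflexive (total x))))) ⟩
    value x               ∎

moveBetween : (x : Height k) (y : Height (suc k)) → Move (above x) (below x) (above y) (below y)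
moveBetween {k} x y = mkMove (trans (total y) (trans (cong suc (+-suc k (k + 0))) (cong (λ n → suc (suc n)) (sym (total x)))))

-- The end point acts as one more height -n, with bound n, so the final vertical run is a move like
-- the others.
floor : n ≡ k → Height k
floor {n} eq = split (2 * n) 0 (trans (+-identityʳ (2 * n)) (cong (2 *_) eq))

toWalk : (x : Height k) (v : Vec ℤ m) → Bounded (suc k) v → n ≡ suc k + m → Walk (2 * n) 0 (suc m) (above x) (below x)
toWalk {k = k} x [] [] eq = moveBetween x (floor (trans eq (+-identityʳ (suc k)))) ∷ []
toWalk {k = k} {m = suc m} x (a ∷ v) (b ∷ bs) eq =
  moveBetween x (height b) ∷ toWalk (height b) v bs (trans eq (+-suc (suc k) m))

nextHeight : (x : Height k) → Move (above x) (below x) c r → Height (suc k)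
nextHeight {k} {c} {r} x p = split c r (trans (Move-sum p) (trans (cong (λ n → suc (suc n)) (total x)) (cong suc (sym (+-suc k (k + 0))))))

-- The last move leads to the end point, so its target is not recorded.
heights : (x : Height k) → Walk c r (suc m) (above x) (below x) → Vec ℤ m
heights x (p ∷ [])      = []
heights x (p ∷ (q ∷ t)) = value (nextHeight x p) ∷ heights (nextHeight x p) (q ∷ t)

heights-moveBetween : (x : Height k) (y : Height (suc k)) (t : Walk c r (suc m) (above y) (below y)) →
                      heights x (moveBetween x y ∷ t) ≡ value y ∷ heights y t
heights-moveBetween x (split d s e) (q ∷ t) =
  cong (λ e → value (split d s e) ∷ heights (split d s e) (q ∷ t)) (uip _ e)

heights-bounded : (x : Height k) (t : Walk c r (suc m) (above x) (below x)) → Bounded (suc k) (heights x t)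
heights-bounded x (p ∷ [])      = []
heights-bounded x (p ∷ (q ∷ t)) = value-inRange (nextHeight x p) ∷ heights-bounded (nextHeight x p) (q ∷ t)

toWalk-heights : (x : Height k) (t : Walk (2 * n) 0 (suc m) (above x) (below x)) (bs : Bounded (suc k) (heights x t)) (eq : n ≡ suc k + m) →
                 toWalk x (heights x t) bs eq ≡ t
toWalk-heights x (p ∷ []) [] eq = cong (_∷ []) (Move-irrelevant _ p)
toWalk-heights {k} {m = suc m} x (p ∷ (q ∷ t)) (b ∷ bs) eq =
  -- Once `height b` is replaced by `nextHeight x p`, both walks visit the same cuts and
  -- `Move-irrelevant` applies.
  trans (cong (λ y → moveBetween x y ∷ toWalk y (heights (nextHeight x p) (q ∷ t)) bs eq′) (height-value (nextHeight x p) b))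
    (cong₂ _∷_ (Move-irrelevant _ p) (toWalk-heights (nextHeight x p) (q ∷ t) bs eq′))
  where
  eq′ = trans eq (+-suc (suc k) m)

heights-toWalk : (x : Height k) (v : Vec ℤ m) (bs : Bounded (suc k) v) (eq : n ≡ suc k + m) →
                 heights x (toWalk x v bs eq) ≡ v
heights-toWalk x [] [] eq = refl
heights-toWalk {k} {suc m} x (a ∷ v) (b ∷ bs) eq =
  trans (heights-moveBetween x (height b) (toWalk (height b) v bs eq′))
    (cong₂ _∷_ (value-height b) (heights-toWalk (height b) v bs eq′))
  where
  eq′ = trans eq (+-suc (suc k) m)

-- North steps as the weight of a walk

countN-++ : ∀ xs ys → countN (xs ++ ys) ≡ countN xs + countN ys
countN-++ []       ys = refl
countN-++ (E ∷ xs) ys = countN-++ xs ys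
countN-++ (N ∷ xs) ys = cong suc (countN-++ xs ys)
countN-++ (S ∷ xs) ys = countN-++ xs ys

positivePart : ℤ → ℕ
positivePart (+ n)    = n
positivePart -[1+ n ] = 0

countN-norths : ∀ n → countN (replicate n N) ≡ n
countN-norths zero    = refl
countN-norths (suc n) = cong suc (countN-norths n)

countN-souths : ∀ n → countN (replicate n S) ≡ 0
countN-souths zero    = refl
countN-souths (suc n) = countN-souths n

countN-vert : ∀ h h′ → countN (vert h h′) ≡ positivePart (h′ ℤ.- h)
countN-vert h h′ with h′ ℤ.- h
... | + n      = countN-norths n
... | -[1+ n ] = countN-souths n

positivePart-⊖ : ∀ m n → positivePart (m ⊖ n) ≡ m ∸ n
positivePart-⊖ m       zero    = refl
positivePart-⊖ zero    (suc n) = refl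
positivePart-⊖ (suc m) (suc n) = trans (cong positivePart (ℤ.[1+m]⊖[1+n]≡m⊖n m n)) (positivePart-⊖ m n)

-- With c and d the codes of y and x, the rise is (k+1-c) - (k-d) = d+1-c; the 1 comes from the
-- growth of the bound.
countN-vert-value : (x : Height k) (y : Height (suc k)) → countN (vert (value x) (value y)) ≡ suc (above x) ∸ above y
countN-vert-value {k} x y = begin
  countN (vert (value x) (value y))           ≡⟨ countN-vert (value x) (value y) ⟩
  positivePart (value y ℤ.- value x)
    ≡⟨ cong positivePart (solve 3 (λ k c d → (con (+ 1) :+ k :- c) :- (k :- d) := con (+ 1) :+ d :- c) refl (+ k) (+ above y) (+ above x)) ⟩
  positivePart (+ suc (above x) ℤ.- + above y) ≡⟨ cong positivePart (ℤ.[+m]-[+n]≡m⊖n (suc (above x)) (above y)) ⟩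
  positivePart (suc (above x) ⊖ above y)      ≡⟨ positivePart-⊖ (suc (above x)) (above y) ⟩
  suc (above x) ∸ above y                     ∎
  where open ≡-Reasoning; open ℤSolver.+-*-Solver

value-floor : (eq : n ≡ k) → value (floor eq) ≡ ℤ.- (+ n)
value-floor {n} refl = solve 1 (λ n → n :- (n :+ (n :+ con (+ 0))) := :- n) refl (+ n)
  where open ℤSolver.+-*-Solver

countN-stepsFrom : (x : Height k) (v : Vec ℤ m) (bs : Bounded (suc k) v) (eq : n ≡ suc k + m) →
                   countN (stepsFrom (value x) v (ℤ.- (+ n))) ≡ wtW (toWalk x v bs eq)
countN-stepsFrom {k} {n = n} x [] [] eq = begin
  countN (vert (value x) (ℤ.- (+ n)))     ≡⟨ cong (λ h → countN (vert (value x) h)) (sym (value-floor eq′)) ⟩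
  countN (vert (value x) (value (floor eq′))) ≡⟨ countN-vert-value x (floor eq′) ⟩
  suc (above x) ∸ 2 * n                   ≡⟨ sym (+-identityʳ _) ⟩
  suc (above x) ∸ 2 * n + 0               ∎
  where
  open ≡-Reasoning
  eq′ = trans eq (+-identityʳ (suc k))
countN-stepsFrom {k} {suc m} {n} x (a ∷ v) (b ∷ bs) eq = begin
  countN (vert (value x) a ++ E ∷ rest a)                ≡⟨ countN-++ (vert (value x) a) _ ⟩
  countN (vert (value x) a) + countN (rest a)            ≡⟨ cong (λ h → countN (vert (value x) h) + countN (rest h)) (sym (value-height b)) ⟩
  countN (vert (value x) (value (height b))) + countN (rest (value (height b)))
    ≡⟨ cong₂ _+_ (countN-vert-value x (height b)) (countN-stepsFrom (height b) v bs (trans eq (+-suc (suc k) m))) ⟩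
  wtW (toWalk x (a ∷ v) (b ∷ bs) eq)                     ∎
  where
  open ≡-Reasoning
  rest : ℤ → List Step
  rest h = stepsFrom h v (ℤ.- (+ n))

Bounded-irrelevant : {v : Vec ℤ m} (p q : Bounded k v) → p ≡ q
Bounded-irrelevant []               []                 = refl
Bounded-irrelevant ((x , y) ∷ p) ((x′ , y′) ∷ q) =
  cong₂ _∷_ (cong₂ _,_ (ℤ.≤-irrelevant x x′) (ℤ.≤-irrelevant y y′)) (Bounded-irrelevant p q)

ground : Height 0
ground = split 0 0 refl

-- The first height is 0, so the run before it is empty and is dropped. The moves lead to the other
-- m heights and then to the end point.
pathWalk : PathP (suc m) → Walk (2 * suc m) 0 (suc m) 0 0
pathWalk (_ ∷ v , _ ∷ bs) = toWalk ground v bs refl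

origin : InRange 0 a → a ≡ + 0
origin (0≤a , a≤0) = ℤ.≤-antisym a≤0 0≤a

pathWalk-injective : (P Q : PathP (suc m)) → pathWalk P ≡ pathWalk Q → P ≡ Q
pathWalk-injective (a ∷ v , b ∷ bs) (a′ ∷ v′ , b′ ∷ bs′) eq
  with refl ← origin b | refl ← origin b′
     | refl ← trans (sym (heights-toWalk ground v bs refl)) (trans (cong (heights ground) eq) (heights-toWalk ground v′ bs′ refl))
  = cong (_ ,_) (Bounded-irrelevant _ _)

pathWalk-surjective : (t : Walk (2 * suc m) 0 (suc m) 0 0) → ∃ λ P → pathWalk P ≡ t
pathWalk-surjective t = (+ 0 ∷ heights ground t , (ℤ.≤-refl , ℤ.≤-refl) ∷ heights-bounded ground t) , toWalk-heights ground t _ refl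

northSteps≡wtW : (P : PathP (suc m)) → northSteps (suc m) P ≡ wtW (pathWalk P)
northSteps≡wtW (a ∷ v , b ∷ bs) with refl ← origin b = countN-stepsFrom ground v bs refl

-- Matchings as histories

-- The partner of the old point i once a new point `zero` is joined to b, where x was its partner
-- before.
join : Fin m → Fin m → Fin m → Fin (suc m)
join b i x with i ≟ b
... | yes _ = zero
... | no  _ = suc x

join-≡ : (b x : Fin m) → join b b x ≡ zero
join-≡ b x with b ≟ b
... | yes _   = refl
... | no  b≢b = contradiction refl b≢b

join-≢ : {b i : Fin m} → i ≢ b → (x : Fin m) → join b i x ≡ suc x
join-≢ {b = b} {i} i≢b x with i ≟ b
... | yes i≡b = contradiction i≡b i≢b
... | no  _   = refl

-- Here each step of a history adds a point at the front; reversing the order of the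
-- points preserves nestings.  Open arcs are fixed points of mate, and free lists them
-- in increasing order.  Joining the new point to b creates one nesting for each open
-- arc ending after b, so labels count from the top, whence opposite.
free : Left m k → Fin k → Fin m
free (op l)   zero    = zero
free (op l)   (suc i) = suc (free l i)
free (cl l j) i       = suc (free l (punchIn (opposite j) i))

mate : Left m k → Fin m → Fin m
mate (op l)   zero    = zero
mate (op l)   (suc i) = suc (mate l i)
mate (cl l j) zero    = suc (free l (opposite j))
mate (cl l j) (suc i) = join (free l (opposite j)) i (mate l i)

punchIn-mono-< : (i : Fin (suc k)) {x y : Fin k} → x < y → punchIn i x < punchIn i y
punchIn-mono-< i {x} {y} x<y = ℕ.≤∧≢⇒< (Fin.punchIn-mono-≤ i x y (ℕ.<⇒≤ x<y))
  (λ e → ℕ.<⇒≢ x<y (cong toℕ (Fin.punchIn-injective i x y (Fin.toℕ-injective e))))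

free-mono-< : (l : Left m k) {i j : Fin k} → i < j → free l i < free l j
free-mono-< (op l)   {zero}  {suc j} i<j       = z<s
free-mono-< (op l)   {suc i} {suc j} (s<s i<j) = s<s (free-mono-< l i<j)
free-mono-< (cl l j)                 i<j       = s<s (free-mono-< l (punchIn-mono-< (opposite j) i<j))

free-cancel-< : (l : Left m k) {i j : Fin k} → free l i < free l j → i < j
free-cancel-< l {i} {j} h with Fin.<-cmp i j
... | tri< i<j _ _  = i<j
... | tri≈ _ refl _ = contradiction h (Fin.<-irrefl refl)
... | tri> _ _ j<i  = contradiction h (Fin.<-asym (free-mono-< l j<i))

free-injective : (l : Left m k) {i j : Fin k} → free l i ≡ free l j → i ≡ j
free-injective l {i} {j} e with Fin.<-cmp i j
... | tri< i<j _ _ = contradiction (free-mono-< l i<j) (Fin.<-irrefl e)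
... | tri≈ _ i≡j _ = i≡j
... | tri> _ _ j<i = contradiction (free-mono-< l j<i) (Fin.<-irrefl (sym e))

free-punchIn≢ : (l : Left m (suc k)) (j : Fin (suc k)) (i : Fin k) → free l (punchIn j i) ≢ free l j
free-punchIn≢ l j i e = Fin.punchInᵢ≢i j i (free-injective l e)

mate-free : (l : Left m k) (i : Fin k) → mate l (free l i) ≡ free l i
mate-free (op l)   zero    = refl
mate-free (op l)   (suc i) = cong suc (mate-free l i)
mate-free (cl l j) i       = trans (join-≢ (free-punchIn≢ l (opposite j) i) _) (cong suc (mate-free l _))

fixed⇒free : (l : Left m k) (i : Fin m) → mate l i ≡ i → ∃ λ j → free l j ≡ i
fixed⇒free (op l)   zero    e = zero , refl
fixed⇒free (op l)   (suc i) e with fixed⇒free l i (Fin.suc-injective e)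
... | j , e′ = suc j , cong suc e′
fixed⇒free (cl l j) (suc i) e with i ≟ free l (opposite j)
... | no i≢b with fixed⇒free l i (Fin.suc-injective e)
... | j′ , e′ = punchOut b≢j′ , cong suc (trans (cong (free l) (Fin.punchIn-punchOut b≢j′)) e′)
  where
  b≢j′ : opposite j ≢ j′
  b≢j′ b≡j′ = i≢b (trans (sym e′) (cong (free l) (sym b≡j′)))

mate-involutive : (l : Left m k) (i : Fin m) → mate l (mate l i) ≡ i
mate-involutive (op l)   zero    = refl
mate-involutive (op l)   (suc i) = cong suc (mate-involutive l i)
mate-involutive (cl l j) zero    = join-≡ (free l (opposite j)) _
mate-involutive (cl l j) (suc i) with i ≟ free l (opposite j)
... | yes i≡b = cong suc (sym i≡b)
... | no  i≢b = trans (join-≢ mate≢b _) (cong suc (mate-involutive l i))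
  where
  mate≢b : mate l i ≢ free l (opposite j)
  mate≢b e = i≢b (trans (sym (mate-involutive l i)) (trans (cong (mate l) e) (mate-free l _)))

opposite-injective : {i j : Fin k} → opposite i ≡ opposite j → i ≡ j
opposite-injective {i = i} {j} e = trans (sym (Fin.opposite-involutive i)) (trans (cong opposite e) (Fin.opposite-involutive j))

join-injective : {b i x y : Fin m} → (i ≡ b → x ≡ y) → join b i x ≡ join b i y → x ≡ y
join-injective {b = b} {i} h e with i ≟ b
... | yes i≡b = h i≡b
... | no  _   = Fin.suc-injective e

-- The partner of `zero` tells `op` from `cl` and gives b, hence the label. Off b the older mates
-- can be read off; at b, where `join` forgets them, both fix b.
mate-injective : (l l′ : Left m k) → mate l ≗ mate l′ → l ≡ l′
mate-injective nil      nil        e = refl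
mate-injective (op l)   (op l′)    e = cong op (mate-injective l l′ (λ i → Fin.suc-injective (e (suc i))))
mate-injective (op l)   (cl l′ j′) e = contradiction (e zero) Fin.0≢1+n
mate-injective (cl l j) (op l′)    e = contradiction (sym (e zero)) Fin.0≢1+n
mate-injective (cl l j) (cl l′ j′) e
  = cl-cong (mate-injective l l′ mate≗) b≡b′
  where
  b≡b′ : free l (opposite j) ≡ free l′ (opposite j′)
  b≡b′ = Fin.suc-injective (e zero)
  mate≗ : mate l ≗ mate l′
  mate≗ i = join-injective
    (λ { refl → trans (mate-free l _) (trans b≡b′ (trans (sym (mate-free l′ _)) (cong (mate l′) (sym b≡b′)))) })
    (trans (e (suc i)) (cong (λ b → join b i (mate l′ i)) (sym b≡b′)))
  cl-cong : l ≡ l′ → free l (opposite j) ≡ free l′ (opposite j′) → cl l j ≡ cl l′ j′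
  cl-cong refl eq = cong (cl l) (opposite-injective (free-injective l eq))

-- Undoes `join`: the point that was joined to `zero` becomes fixed again.
unjoin : Fin m → Fin (suc m) → Fin m
unjoin i zero    = i
unjoin i (suc x) = x

unjoin-suc : {i x : Fin m} (y : Fin (suc m)) → y ≡ suc x → unjoin i y ≡ x
unjoin-suc y refl = refl

unjoin-zero : {i : Fin m} (y : Fin (suc m)) → y ≡ zero → unjoin i y ≡ i
unjoin-zero y refl = refl

suc-unjoin : {i : Fin m} (y : Fin (suc m)) → y ≢ zero → y ≡ suc (unjoin i y)
suc-unjoin zero    y≢0 = contradiction refl y≢0
suc-unjoin (suc x) _   = refl

-- Removing `zero` leaves an involution that fixes the former partner of `zero`, if there was one.
-- In the history of the rest that partner is thus an open arc, which `cl` can close; if `zero` was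
-- fixed, `op` adds it.
mate-surjective : (f : Fin m → Fin m) → (∀ i → f (f i) ≡ i) → ∃₂ λ k (l : Left m k) → mate l ≗ f
mate-surjective {zero}  f inv = 0 , nil , λ ()
mate-surjective {suc m} f inv = extend (mate-surjective rest rest-inv) (f zero) refl
  where
  rest : Fin m → Fin m
  rest i = unjoin i (f (suc i))

  rest-inv : ∀ i → rest (rest i) ≡ i
  rest-inv i with f (suc i) in eq
  ... | zero  = unjoin-zero (f (suc i)) eq
  ... | suc x = unjoin-suc (f (suc x)) (trans (cong f (sym eq)) (inv (suc i)))

  extend : (∃₂ λ k (l : Left m k) → mate l ≗ rest) → ∀ y → f zero ≡ y → ∃₂ λ k (l : Left (suc m) k) → mate l ≗ f
  extend (k , l , h) zero f0 = suc k , op l , λ where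
      zero    → sym f0
      (suc i) → trans (cong suc (h i)) (sym (suc-unjoin (f (suc i))
                  (λ e → Fin.0≢1+n (trans (sym f0) (trans (cong f (sym e)) (inv (suc i)))))))
  extend (k , l , h) (suc b) f0 with fixed⇒free l b (trans (h b) (unjoin-zero (f (suc b)) fb))
    where
    fb : f (suc b) ≡ zero
    fb = trans (cong f (sym f0)) (inv zero)
  extend (suc k , l , h) (suc b) f0 | j , refl = k , cl l (opposite j) , mate≗
    where
    j≡ = Fin.opposite-involutive j
    mate≗ : mate (cl l (opposite j)) ≗ f
    mate≗ zero    = trans (cong (suc ∘ free l) j≡) (sym f0)
    mate≗ (suc i) rewrite j≡ with i ≟ free l j
    ... | yes refl = sym (trans (cong f (sym f0)) (inv zero))
    ... | no  i≢b  = trans (cong suc (h i)) (sym (suc-unjoin (f (suc i))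
                       (λ e → i≢b (Fin.suc-injective (trans (sym (inv (suc i))) (trans (cong f e) f0))))))

-- Labels count nestings

⟦_⟧ : {P : Set} → Dec P → ℕ
⟦ p ⟧ = if does p then 1 else 0

⟦⟧-cong : {P Q : Set} (p : Dec P) (q : Dec Q) → (P → Q) → (Q → P) → ⟦ p ⟧ ≡ ⟦ q ⟧
⟦⟧-cong (yes _) (yes _) f g = refl
⟦⟧-cong (yes p) (no ¬q) f g = contradiction (f p) ¬q
⟦⟧-cong (no ¬p) (yes q) f g = contradiction (g q) ¬p
⟦⟧-cong (no _)  (no _)  f g = refl

⟦⟧-no : {P : Set} (p : Dec P) → ¬ P → ⟦ p ⟧ ≡ 0
⟦⟧-no (yes p) ¬p = contradiction p ¬p
⟦⟧-no (no _)  _  = refl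

⟦⟧-yes : {P : Set} (p : Dec P) → P → ⟦ p ⟧ ≡ 1
⟦⟧-yes (yes _) _ = refl
⟦⟧-yes (no ¬p) p = contradiction p ¬p

sum-zero : {f : Fin m → ℕ} → (∀ i → f i ≡ 0) → sum f ≡ 0
sum-zero {m} h = trans (sum-cong-≗ h) (sum-replicate-zero m)

sum-extract : (b : Fin m) (f g : Fin m → ℕ) → g b ≡ 0 → (∀ i → i ≢ b → g i ≡ f i) → sum f ≡ f b + sum g
sum-extract {suc m} b f g gb g≗f = begin
  sum f                        ≡⟨ sum-remove f ⟩
  f b + sum (f ∘ punchIn b)    ≡⟨ cong (_+_ (f b)) (sum-cong-≗ (λ i → sym (g≗f _ (Fin.punchInᵢ≢i b i)))) ⟩
  f b + sum (g ∘ punchIn b)    ≡⟨ cong (λ x → f b + (x + sum (g ∘ punchIn b))) (sym gb) ⟩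
  f b + (g b + sum (g ∘ punchIn b)) ≡⟨ cong (_+_ (f b)) (sym (sum-remove g)) ⟩
  f b + sum g                  ∎
  where open ≡-Reasoning

-- Under `cl` the fixed points lose exactly b, and `free` loses its entry at `opposite j`. Adding
-- `g (suc b)` to both sides restores the sums for l.
sum-fixed : (l : Left m k) (g : Fin m → ℕ) → sum (λ i → ⟦ mate l i ≟ i ⟧ * g i) ≡ sum (g ∘ free l)
sum-fixed nil      g = refl
sum-fixed (op l)   g = cong₂ _+_ (+-identityʳ (g zero)) (begin
  sum (λ i → ⟦ suc (mate l i) ≟ suc i ⟧ * g (suc i))
    ≡⟨ sum-cong-≗ (λ i → cong (_* g (suc i)) (⟦⟧-cong (suc (mate l i) ≟ suc i) (mate l i ≟ i) Fin.suc-injective (cong suc))) ⟩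
  sum (λ i → ⟦ mate l i ≟ i ⟧ * g (suc i))            ≡⟨ sum-fixed l (g ∘ suc) ⟩
  sum (g ∘ suc ∘ free l)                              ∎)
  where open ≡-Reasoning
sum-fixed {suc m} (cl l j) g = +-cancelˡ-≡ (g (suc b)) _ _ (begin
  g (suc b) + sum G                                   ≡⟨ cong (_+ sum G) (sym Fb) ⟩
  F b + sum G                                         ≡⟨ sym (sum-extract b F G Gb G≗F) ⟩
  sum F                                               ≡⟨ sum-fixed l (g ∘ suc) ⟩
  sum (g ∘ suc ∘ free l)                              ≡⟨ sum-remove {i = opposite j} (g ∘ suc ∘ free l) ⟩
  g (suc b) + sum (g ∘ free (cl l j))                 ∎)
  where
  open ≡-Reasoning
  b = free l (opposite j)
  F G : Fin m → ℕ
  F i = ⟦ mate l i ≟ i ⟧ * g (suc i)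
  G i = ⟦ join b i (mate l i) ≟ suc i ⟧ * g (suc i)
  Fb : F b ≡ g (suc b)
  Fb = trans (cong (_* g (suc b)) (⟦⟧-yes (mate l b ≟ b) (mate-free l (opposite j)))) (*-identityˡ _)
  Gb : G b ≡ 0
  Gb = cong (_* g (suc b)) (⟦⟧-no (join b b (mate l b) ≟ suc b) (λ e → Fin.0≢1+n (trans (sym (join-≡ b _)) e)))
  G≗F : ∀ i → i ≢ b → G i ≡ F i
  G≗F i i≢b = cong (_* g (suc i)) (⟦⟧-cong (join b i (mate l i) ≟ suc i) (mate l i ≟ i)
    (λ e → Fin.suc-injective (trans (sym (join-≢ i≢b _)) e)) (λ e → trans (join-≢ i≢b _) (cong suc e)))

count-above : (i : Fin k) → sum (λ (j : Fin k) → ⟦ i <? j ⟧) ≡ toℕ (opposite i)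
count-above {suc k} zero    = begin
  sum (λ (j : Fin k) → ⟦ zero {k} <? suc j ⟧) ≡⟨ sum-cong-≗ (λ (j : Fin k) → ⟦⟧-yes (zero {k} <? suc j) z<s) ⟩
  sum {k} (λ _ → 1)                 ≡⟨ sum-ones k ⟩
  k                                 ≡⟨ sym (Fin.toℕ-fromℕ k) ⟩
  toℕ (opposite {suc k} zero)       ∎
  where
  open ≡-Reasoning
  sum-ones : ∀ k → sum {k} (λ _ → 1) ≡ k
  sum-ones zero    = refl
  sum-ones (suc k) = cong suc (sum-ones k)
count-above {suc k} (suc i) = begin
  sum (λ (j : Fin k) → ⟦ suc i <? suc j ⟧)
    ≡⟨ sum-cong-≗ (λ (j : Fin k) → ⟦⟧-cong (suc i <? suc j) (i <? j) (λ { (s<s h) → h }) s<s) ⟩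
  sum (λ (j : Fin k) → ⟦ i <? j ⟧)            ≡⟨ count-above i ⟩
  toℕ (opposite i)                  ≡⟨ sym (Fin.toℕ-inject₁ (opposite i)) ⟩
  toℕ (opposite (suc i))            ∎
  where open ≡-Reasoning

-- A fixed point i stands for an arc ending at i and starting before all points.
Nested : (Fin m → Fin m) → Fin m → Fin m → Set
Nested f i j = (i < j ⊎ f i ≡ i) × j < f j × f j < f i

nested? : (f : Fin m → Fin m) (i j : Fin m) → Dec (Nested f i j)
nested? f i j = (i <? j ⊎-dec f i ≟ i) ×-dec (j <? f j ×-dec f j <? f i)

row : (Fin m → Fin m) → Fin m → ℕ
row f i = sum (λ j → ⟦ nested? f i j ⟧)

nestings : (Fin m → Fin m) → ℕ
nestings f = sum (row f)

-- The new open arc ends at the first point, so it encloses nothing; and an open arc never counts as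
-- an inner one.
nestings-op : (l : Left m k) → nestings (mate (op l)) ≡ nestings (mate l)
nestings-op l = cong₂ _+_
  (sum-zero (λ j → ⟦⟧-no (nested? (mate (op l)) zero j) (λ { (_ , _ , ()) })))
  (sum-cong-≗ (λ i → cong₂ _+_
    (⟦⟧-no (nested? (mate (op l)) (suc i) zero) (λ { (_ , () , _) }))
    (sum-cong-≗ (λ j → ⟦⟧-cong (nested? (mate (op l)) (suc i) (suc j)) (nested? (mate l) i j)
      (λ { (inj₁ (s<s a) , s<s b , s<s c) → inj₁ a , b , c ; (inj₂ a , s<s b , s<s c) → inj₂ (Fin.suc-injective a) , b , c })
      (λ { (inj₁ a , b , c) → inj₁ (s<s a) , s<s b , s<s c ; (inj₂ a , b , c) → inj₂ (cong suc a) , s<s b , s<s c })))))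

⟦⟧-×-dec : {P Q : Set} (p : Dec P) (q : Dec Q) → ⟦ p ×-dec q ⟧ ≡ ⟦ p ⟧ * ⟦ q ⟧
⟦⟧-×-dec (yes _) q = sym (*-identityˡ ⟦ q ⟧)
⟦⟧-×-dec (no _)  q = refl

-- The new arc takes over the row of the open arc b, the row of `suc b` becomes empty, and the other
-- rows keep their entries. What is added is the column `C` of arcs around the new one: only an open
-- arc can start before `zero`, and it must end after b.
nestings-cl : (l : Left m (suc k)) (j : Fin (suc k)) → nestings (mate (cl l j)) ≡ toℕ j + nestings (mate l)
nestings-cl {m} {k} l j = begin
  row τ zero + sum (λ i → C i + R i)       ≡⟨ cong₂ _+_ row-zero (∑-distrib-+ C R) ⟩
  row σ b + (sum C + sum R)                ≡⟨ solve 3 (λ x y z → x :+ (y :+ z) := y :+ (x :+ z)) refl (row σ b) (sum C) (sum R) ⟩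
  sum C + (row σ b + sum R)                ≡⟨ cong₂ _+_ sum-C (sym (sum-extract b (row σ) R Rb R≗row)) ⟩
  toℕ j + nestings σ                       ∎
  where
  open ≡-Reasoning
  open +-*-Solver using (solve; _:+_; _:=_)
  σ = mate l
  τ = mate (cl l j)
  b = free l (opposite j)

  σb : σ b ≡ b
  σb = mate-free l (opposite j)

  C R : Fin m → ℕ
  C i = ⟦ nested? τ (suc i) zero ⟧
  R i = sum (λ x → ⟦ nested? τ (suc i) (suc x) ⟧)

  -- An inner arc is listed by its left end. Before the join b is fixed, afterwards it is a right
  -- end; so at inner arcs `join` is just `suc`.
  opens≢b : ∀ x → x < σ x → x ≢ b
  opens≢b x x<σx refl = Fin.<-irrefl (sym σb) x<σx

  opens≢b′ : ∀ x → suc x < τ (suc x) → x ≢ b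
  opens≢b′ x h refl with () ← subst (suc x <_) (join-≡ b (σ b)) h

  row-zero : row τ zero ≡ row σ b
  row-zero = cong₂ _+_
    (⟦⟧-no (nested? τ zero zero) (λ { (inj₁ () , _) ; (inj₂ () , _) }))
    (sum-cong-≗ (λ x → ⟦⟧-cong (nested? τ zero (suc x)) (nested? σ b x) (to x) (from x)))
    where
    to : ∀ x → Nested τ zero (suc x) → Nested σ b x
    to x (_ , h , h′) with e ← join-≢ (opens≢b′ x h) (σ x) =
      inj₂ σb , ℕ.s<s⁻¹ (subst (suc x <_) e h) , subst (σ x <_) (sym σb) (ℕ.s<s⁻¹ (subst (_< suc b) e h′))
    from : ∀ x → Nested σ b x → Nested τ zero (suc x)
    from x (_ , h , h′) with e ← join-≢ (opens≢b x h) (σ x) =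
      inj₁ z<s , subst (suc x <_) (sym e) (s<s h) , subst (_< suc b) (sym e) (s<s (subst (σ x <_) σb h′))

  Rb : R b ≡ 0
  Rb = sum-zero (λ x → ⟦⟧-no (nested? τ (suc b) (suc x))
    (λ { (_ , _ , h) → impossible (subst (τ (suc x) <_) (join-≡ b (σ b)) h) }))
    where
    impossible : {y : Fin (suc m)} → ¬ y < zero {m}
    impossible ()

  R≗row : ∀ i → i ≢ b → R i ≡ row σ i
  R≗row i i≢b = sum-cong-≗ (λ x → ⟦⟧-cong (nested? τ (suc i) (suc x)) (nested? σ i x) (to x) (from x))
    where
    eᵢ = join-≢ i≢b (σ i)
    to : ∀ x → Nested τ (suc i) (suc x) → Nested σ i x
    to x (a , h , h′) with e ← join-≢ (opens≢b′ x h) (σ x) =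
      (case a) , ℕ.s<s⁻¹ (subst (suc x <_) e h) , ℕ.s<s⁻¹ (subst₂ _<_ e eᵢ h′)
      where
      case : suc i < suc x ⊎ τ (suc i) ≡ suc i → i < x ⊎ σ i ≡ i
      case (inj₁ p) = inj₁ (ℕ.s<s⁻¹ p)
      case (inj₂ p) = inj₂ (Fin.suc-injective (trans (sym eᵢ) p))
    from : ∀ x → Nested σ i x → Nested τ (suc i) (suc x)
    from x (a , h , h′) with e ← join-≢ (opens≢b x h) (σ x) =
      (case a) , subst (suc x <_) (sym e) (s<s h) , subst₂ _<_ (sym e) (sym eᵢ) (s<s h′)
      where
      case : i < x ⊎ σ i ≡ i → suc i < suc x ⊎ τ (suc i) ≡ suc i
      case (inj₁ p) = inj₁ (s<s p)
      case (inj₂ p) = inj₂ (trans eᵢ (cong suc p))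

  C≗ : ∀ i → C i ≡ ⟦ σ i ≟ i ⟧ * ⟦ b <? i ⟧
  C≗ i = trans (⟦⟧-cong (nested? τ (suc i) zero) (σ i ≟ i ×-dec b <? i) to from) (⟦⟧-×-dec (σ i ≟ i) (b <? i))
    where
    to : Nested τ (suc i) zero → σ i ≡ i × b < i
    to (inj₁ () , _)
    to (inj₂ e , _ , h) = Fin.suc-injective (trans (sym (join-≢ i≢b _)) e) , ℕ.s<s⁻¹ (subst (suc b <_) e h)
      where
      i≢b : i ≢ b
      i≢b refl = Fin.0≢1+n (trans (sym (join-≡ b _)) e)
    from : σ i ≡ i × b < i → Nested τ (suc i) zero
    from (e , b<i) = inj₂ eᵢ , z<s , subst (suc b <_) (sym eᵢ) (s<s b<i)
      where
      eᵢ : τ (suc i) ≡ suc i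
      eᵢ = trans (join-≢ (λ i≡b → Fin.<-irrefl (sym i≡b) b<i) _) (cong suc e)

  -- As `free` is increasing, the open arcs after b are those with index above `opposite j`, and
  -- there are j of these.
  sum-C : sum C ≡ toℕ j
  sum-C = begin
    sum C                                          ≡⟨ sum-cong-≗ C≗ ⟩
    sum (λ i → ⟦ σ i ≟ i ⟧ * ⟦ b <? i ⟧)           ≡⟨ sum-fixed l (λ i → ⟦ b <? i ⟧) ⟩
    sum (λ i → ⟦ b <? free l i ⟧)
      ≡⟨ sum-cong-≗ (λ i → ⟦⟧-cong (b <? free l i) (opposite j <? i) (free-cancel-< l) (free-mono-< l)) ⟩
    sum (λ (i : Fin (suc k)) → ⟦ opposite j <? i ⟧) ≡⟨ count-above (opposite j) ⟩
    toℕ (opposite (opposite j))                    ≡⟨ cong toℕ (Fin.opposite-involutive j) ⟩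
    toℕ j                                          ∎

nestings-mate : (l : Left m k) → nestings (mate l) ≡ wtL l
nestings-mate nil      = refl
nestings-mate (op l)   = trans (nestings-op l) (nestings-mate l)
nestings-mate (cl l j) = trans (nestings-cl l j) (cong (_+_ (toℕ j)) (nestings-mate l))

-- Histories without open arcs as matchings, and their `ne`

length-filter-tabulate : {A : Set} {P : A → Set} (P? : Decidable P) (f : Fin m → A) →
                         List.length (List.filter P? (List.tabulate f)) ≡ sum (λ i → ⟦ P? (f i) ⟧)
length-filter-tabulate {zero}  P? f = refl
length-filter-tabulate {suc m} P? f with P? (f zero)
... | yes _ = cong suc (length-filter-tabulate P? (f ∘ suc))
... | no  _ = length-filter-tabulate P? (f ∘ suc)

length-filter-cartesianProduct :
  {A B : Set} {P : A × B → Set} (P? : Decidable P) (f : Fin m → A) (g : Fin k → B) →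
  List.length (List.filter P? (List.cartesianProduct (List.tabulate f) (List.tabulate g)))
    ≡ sum (λ i → sum (λ j → ⟦ P? (f i , g j) ⟧))
length-filter-cartesianProduct {zero}  P? f g = refl
length-filter-cartesianProduct {suc m} P? f g = begin
  List.length (List.filter P? (first List.++ rest))                             ≡⟨ cong List.length (List.filter-++ P? first rest) ⟩
  List.length (List.filter P? first List.++ List.filter P? rest)                ≡⟨ List.length-++ (List.filter P? first) ⟩
  List.length (List.filter P? first) + List.length (List.filter P? rest)
    ≡⟨ cong₂ _+_ (trans (cong (List.length ∘ List.filter P?) (List.map-tabulate g (f zero ,_))) (length-filter-tabulate P? (λ j → f zero , g j)))
                 (length-filter-cartesianProduct P? (f ∘ suc) g) ⟩
  sum (λ i → sum (λ j → ⟦ P? (f i , g j) ⟧))                                    ∎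
  where
  open ≡-Reasoning
  first = List.map (f zero ,_) (List.tabulate g)
  rest  = List.cartesianProduct (List.tabulate (f ∘ suc)) (List.tabulate g)

mate-moves : (l : Left m 0) (i : Fin m) → i < mate l i ⊎ mate l i < i
mate-moves l i with Fin.<-cmp i (mate l i)
... | tri< i<mi _ _ = inj₁ i<mi
... | tri> _ _ mi<i = inj₂ mi<i
... | tri≈ _ i≡mi _ with () ← proj₁ (fixed⇒free l i (sym i≡mi))

matching : ∀ n → Left (2 * n) 0 → Matching n
matching n l = v , All.tabulate⁺ (λ i →
    trans (cong (lookup v) (look i)) (trans (look (mate l i)) (mate-involutive l i))
  , subst (λ x → i < x ⊎ x < i) (sym (look i)) (mate-moves l i))
  where
  v = tabulate (mate l)
  look = lookup∘tabulate (mate l)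

IsMatching-irrelevant : {v : Vec (Fin m) m} (p q : IsMatching v) → p ≡ q
IsMatching-irrelevant = All.irrelevant λ where
  (p , inj₁ a) (q , inj₁ b) → cong₂ _,_ (uip p q) (cong inj₁ (Fin.<-irrelevant a b))
  (p , inj₂ a) (q , inj₂ b) → cong₂ _,_ (uip p q) (cong inj₂ (Fin.<-irrelevant a b))
  (_ , inj₁ a) (_ , inj₂ b) → contradiction b (Fin.<-asym a)
  (_ , inj₂ a) (_ , inj₁ b) → contradiction b (Fin.<-asym a)

Matching-≡ : ∀ {n} {M M′ : Matching n} → proj₁ M ≡ proj₁ M′ → M ≡ M′
Matching-≡ {M = v , p} {_ , q} refl = cong (v ,_) (IsMatching-irrelevant {v = v} p q)

IsMatching-at : {v : Vec (Fin m) m} → IsMatching v → ∀ i → lookup v (lookup v i) ≡ i × (i < lookup v i ⊎ lookup v i < i)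
IsMatching-at p = All.tabulate⁻ p

matching-injective : ∀ n {l l′ : Left (2 * n) 0} → matching n l ≡ matching n l′ → l ≡ l′
matching-injective n {l} {l′} e = mate-injective l l′ (λ i → begin
  mate l i                      ≡⟨ sym (lookup∘tabulate (mate l) i) ⟩
  lookup (tabulate (mate l)) i  ≡⟨ cong (λ M → lookup (proj₁ M) i) e ⟩
  lookup (tabulate (mate l′)) i ≡⟨ lookup∘tabulate (mate l′) i ⟩
  mate l′ i                     ∎)
  where open ≡-Reasoning

matching-surjective : ∀ n (M : Matching n) → ∃ λ l → matching n l ≡ M
matching-surjective n (v , p) with mate-surjective (lookup v) (λ i → proj₁ (IsMatching-at {v = v} p i))
... | zero  , l , h = l , Matching-≡ {n} (trans (tabulate-cong h) (tabulate∘lookup v))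
-- An arc left open would be a fixed point of the matching.
... | suc k , l , h = ⊥-elim (unfixed (proj₂ (IsMatching-at {v = v} p i)))
  where
  i = free l zero
  fixed : lookup v i ≡ i
  fixed = trans (sym (h i)) (mate-free l zero)
  unfixed : ¬ (i < lookup v i ⊎ lookup v i < i)
  unfixed (inj₁ h) = Fin.<-irrefl (sym fixed) h
  unfixed (inj₂ h) = Fin.<-irrefl fixed h

-- With no open arcs there are no fixed points, so `Nested` reduces to the usual nesting condition.
ne-matching : ∀ n (l : Left (2 * n) 0) → ne n (matching n l) ≡ wtL l
ne-matching n l = begin
  ne n (matching n l)
    ≡⟨ length-filter-cartesianProduct (nestingAt? (tabulate (mate l))) id id ⟩
  sum (λ i → sum (λ j → ⟦ nestingAt? (tabulate (mate l)) (i , j) ⟧))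
    ≡⟨ sum-cong-≗ (λ i → sum-cong-≗ (λ j → ⟦⟧-cong (nestingAt? (tabulate (mate l)) (i , j)) (nested? (mate l) i j) (to i j) (from i j))) ⟩
  nestings (mate l)
    ≡⟨ nestings-mate l ⟩
  wtL l ∎
  where
  open ≡-Reasoning
  look = lookup∘tabulate (mate l)
  NestingAt : Fin (2 * n) → Fin (2 * n) → Set
  NestingAt i j = i < j × j < lookup (tabulate (mate l)) j × lookup (tabulate (mate l)) j < lookup (tabulate (mate l)) i
  to : ∀ i j → NestingAt i j → Nested (mate l) i j
  to i j (p , q , r) = inj₁ p , subst (j <_) (look j) q , subst₂ _<_ (look j) (look i) r
  from : ∀ i j → Nested (mate l) i j → NestingAt i j
  from i j (inj₁ p , q , r) = p , subst (j <_) (sym (look j)) q , subst₂ _<_ (sym (look j)) (sym (look i)) r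
  from i j (inj₂ e , _) with () ← proj₁ (fixed⇒free l i e)

-- The bijection from paths to matchings

strip : Cut c 0 → Left c 0
strip (_ , l , nil) = l

wt-strip : (x : Cut c 0) → wt x ≡ wtL (strip x)
wt-strip (_ , l , nil) = +-identityʳ (wtL l)

strip-injective : (x y : Cut c 0) → strip x ≡ strip y → x ≡ y
strip-injective (_ , l , nil) (_ , _ , nil) refl = refl

pathCut : PathP (suc m) → Cut (2 * suc m) 0
pathCut P = run (pathWalk P) start

pathMatching : PathP (suc m) → Matching (suc m)
pathMatching {m} P = matching (suc m) (strip (pathCut P))

pathMatching-injective : {P Q : PathP (suc m)} → pathMatching P ≡ pathMatching Q → P ≡ Q
pathMatching-injective {m} {P} {Q} e =
  pathWalk-injective P Q (run-start-injective (+-identityʳ (2 * suc m)) (pathWalk P) (pathWalk Q)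
    (strip-injective (pathCut P) (pathCut Q) (matching-injective (suc m) e)))

pathMatching-surjective : (M : Matching (suc m)) → ∃ λ P → pathMatching P ≡ M
pathMatching-surjective {m} M
  with l , refl ← matching-surjective (suc m) M
  with t , eq ← run-start-surjective {m = suc m} (+-identityʳ (2 * suc m)) (0 , l , nil)
  with P , refl ← pathWalk-surjective t
  = P , cong (matching (suc m) ∘ strip) eq

northSteps≡ne : (P : PathP (suc m)) → northSteps (suc m) P ≡ ne (suc m) (pathMatching P)
northSteps≡ne {m} P = begin
  northSteps (suc m) P                   ≡⟨ northSteps≡wtW P ⟩
  wtW (pathWalk P)                       ≡⟨ sym (+-identityʳ _) ⟩
  wtW (pathWalk P) + 0                   ≡⟨ sym (wt-run (pathWalk P) start) ⟩
  wt (pathCut P)                         ≡⟨ wt-strip (pathCut P) ⟩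
  wtL (strip (pathCut P))                ≡⟨ sym (ne-matching (suc m) (strip (pathCut P))) ⟩
  ne (suc m) (pathMatching P)            ∎
  where open ≡-Reasoning

theorem1 : (n : ℕ) → n ≥ 1 →
    Σ (Bijection (setoid (PathP n)) (setoid (Matching n)))
    (λ Φ → (P : PathP n) → northSteps n P ≡ ne n (Bijection.to Φ P))
theorem1 (suc m) _ = Φ , northSteps≡ne
  where
  Φ : Bijection (setoid (PathP (suc m))) (setoid (Matching (suc m)))
  Φ = record
    { to        = pathMatching
    ; cong      = cong pathMatching
    ; bijective = pathMatching-injective
                , λ M → let (P , eq) = pathMatching-surjective M in P , λ { refl → eq }
    }
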